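{- Let $(P,\rho,\bar\zeta)$ be an Eulerian quasi-graded poset of rank $n+1$ with $\hat0$ and $\hat1$. Then the symmetric relation $$\bar h_S=\bar h_{\overline S}$$ holds for all subsets $S\subseteq\{1,2,\ldots,n\}$, where $\overline S=\{1,\ldots,n\}\setminus S$.
   Context: A quasi-graded poset $(P,\rho,\bar\zeta)$ consists of a finite poset $P$, a function $\rho:P\to\mathbb N$ with $x<y\Rightarrow\rho(x)<\rho(y)$, and a complex-valued function $\bar\zeta$ in the incidence algebra of $P$ with $\bar\zeta(x,x)=1$ for all $x$. Write $\rho(x,y)=\rho(y)-\rho(x)$. It is Eulerian if for all $x\le z$ $$\sum_{x\le y\le z}(-1)^{\rho(x,y)}\,\bar\zeta(x,y)\,\bar\zeta(y,z)=\delta_{x,z}.$$ If $P$ has a minimal element $\hat0$ and maximal element $\hat1$, normalize $\rho(\hat0)=0$; $P$ has rank $n+1$ ($n\ge0$) if $\rho(\hat1)=n+1$. For $S=\{s_1<\cdots<s_k\}\subseteq\{1,\ldots,n\}$ the flag $\bar f$-vector is $\bar f_S=\sum_{c}\bar\zeta(x_0,x_1)\cdots\bar\zeta(x_k,x_{k+1})$, the sum over all chains $c=\{\hat0=x_0<x_1<\cdots<x_{k+1}=\hat1\}$ with $\rho(x_i)=s_i$ for $1\le i\le k$. The flag $\bar h$-vector is $\bar h_S=\sum_{T\subseteq S}(-1)^{|S\setminus T|}\bar f_T$. -}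

module Defs where

open import Level using (Level; 0ℓ; _⊔_)
open import Algebra.Bundles using (CommutativeRing)
import Algebra.Properties.Semiring.Exp as SemiringExp
import Data.Rational as ℚ
import Data.Rational.Properties as ℚ
import Data.Rational.Solver as ℚ
import Data.Nat as ℕ
import Data.Nat.Properties as ℕ
import Relation.Binary.Construct.NonStrictToStrict as ToStrict
open import Data.Fin using (Fin; toℕ)
open import Data.Fin.Subset using (Subset; inside; outside; _⊆_; _─_; ∣_∣)
open import Data.Fin.Subset.Properties using (_∈?_; _⊆?_)
open import Data.List using (List; []; _∷_; _++_; [_]; map; foldr; filter; length; allFin; cartesianProductWith)
open import Data.List.Properties using (≡-dec)
open import Data.List.Relation.Unary.Linked using (Linked; linked?)
open import Data.Nat using (ℕ; zero; suc; _∸_)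
open import Data.Product using (∃; _×_; _,_; proj₁; proj₂)
open import Data.Rational using (ℚ; 0ℚ; 1ℚ; ½)
open import Data.Vec using ([]; _∷_)
open import Function using (_∘_; _↔_; Inverse)
open import Relation.Binary.Core using (Rel)
open import Relation.Binary.Definitions using (Decidable; Minimum; Maximum)
open import Relation.Binary.PropositionalEquality using (_≡_; refl; sym; trans; cong; subst)
open import Relation.Binary.Structures using (IsDecPartialOrder)
open import Relation.Nullary using (¬_; yes; no)
open import Relation.Nullary.Decidable using (_×-dec_)

-- The standard library has no real numbers: ℝ is the setoid of Cauchy sequences of rationals,
-- and ℂ the setoid of pairs of reals.

Sequence : Set
Sequence = ℕ → ℚ

infix 4 _∼_

-- On Cauchy sequences this is the usual equivalence "the difference tends to 0";
-- on the diagonal, x ∼ x says precisely that x is Cauchy.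
_∼_ : Rel Sequence 0ℓ
x ∼ y = ∀ ε → 0ℚ ℚ.< ε → ∃ λ N → ∀ m n → N ℕ.≤ m → N ℕ.≤ n → ℚ.∣ x m ℚ.- y n ∣ ℚ.≤ ε

private
  ½-pos : ∀ {ε} → 0ℚ ℚ.< ε → 0ℚ ℚ.< ½ ℚ.* ε
  ½-pos {ε} 0<ε = subst (ℚ._< ½ ℚ.* ε) (ℚ.*-zeroʳ ½) (ℚ.*-monoʳ-<-pos ½ 0<ε)

  halves : ∀ ε → ½ ℚ.* ε ℚ.+ ½ ℚ.* ε ≡ ε
  halves ε = trans (sym (ℚ.*-distribʳ-+ ε ½ ½)) (ℚ.*-identityˡ ε)

  split : ∀ {p q r ε} → p ≡ q ℚ.+ r → ℚ.∣ q ∣ ℚ.≤ ½ ℚ.* ε → ℚ.∣ r ∣ ℚ.≤ ½ ℚ.* ε → ℚ.∣ p ∣ ℚ.≤ ε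
  split {q = q} {r} {ε} refl q≤ r≤ =
    ℚ.≤-trans (ℚ.∣p+q∣≤∣p∣+∣q∣ q r) (ℚ.≤-trans (ℚ.+-mono-≤ q≤ r≤) (ℚ.≤-reflexive (halves ε)))

  ∣-∣-swap : ∀ p q → ℚ.∣ p ℚ.- q ∣ ≡ ℚ.∣ q ℚ.- p ∣
  ∣-∣-swap p q = trans (cong ℚ.∣_∣ eq) (ℚ.∣-p∣≡∣p∣ (q ℚ.- p))
    where
    open ℚ.+-*-Solver
    eq : p ℚ.- q ≡ ℚ.- (q ℚ.- p)
    eq = solve 2 (λ p q → p :- q := :- (q :- p)) refl p q

∼-sym : ∀ {x y} → x ∼ y → y ∼ x
∼-sym {x} {y} p ε 0<ε with N , h ← p ε 0<ε =
  N , λ m n N≤m N≤n → subst (ℚ._≤ ε) (∣-∣-swap (x n) (y m)) (h n m N≤n N≤m)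

∼-trans : ∀ {x y z} → x ∼ y → y ∼ z → x ∼ z
∼-trans {x} {y} {z} p q ε 0<ε
  with N , h ← p (½ ℚ.* ε) (½-pos 0<ε) | M , k ← q (½ ℚ.* ε) (½-pos 0<ε) =
  L , λ m n L≤m L≤n → split (eq (x m) (y L) (z n))
    (h m L (ℕ.≤-trans N≤L L≤m) N≤L) (k L n M≤L (ℕ.≤-trans M≤L L≤n))
  where
  L = N ℕ.⊔ M
  N≤L = ℕ.m≤m⊔n N M
  M≤L = ℕ.m≤n⊔m N M
  open ℚ.+-*-Solver
  eq : ∀ a b c → a ℚ.- c ≡ (a ℚ.- b) ℚ.+ (b ℚ.- c)
  eq = solve 3 (λ a b c → a :- c := (a :- b) :+ (b :- c)) refl

∼-resp-≗ : ∀ {x y} → x ∼ x → (∀ n → x n ≡ y n) → x ∼ y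
∼-resp-≗ {x} p x≗y ε 0<ε with N , h ← p ε 0<ε =
  N , λ m n N≤m N≤n → subst (λ t → ℚ.∣ x m ℚ.- t ∣ ℚ.≤ ε) (x≗y n) (h m n N≤m N≤n)

infixl 6 _+ˢ_
infixl 7 _*ˢ_

_+ˢ_ _*ˢ_ : Sequence → Sequence → Sequence
(x +ˢ y) n = x n ℚ.+ y n
(x *ˢ y) n = x n ℚ.* y n

-ˢ_ : Sequence → Sequence
(-ˢ x) n = ℚ.- x n

constant-∼ : ∀ q → (λ _ → q) ∼ (λ _ → q)
constant-∼ q ε 0<ε = 0 , λ _ _ _ _ →
  subst (ℚ._≤ ε) (sym (cong ℚ.∣_∣ (ℚ.+-inverseʳ q))) (ℚ.<⇒≤ 0<ε)

+ˢ-cong : ∀ {x x′ y y′} → x ∼ x′ → y ∼ y′ → x +ˢ y ∼ x′ +ˢ y′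
+ˢ-cong {x} {x′} {y} {y′} p q ε 0<ε
  with N , h ← p (½ ℚ.* ε) (½-pos 0<ε) | M , k ← q (½ ℚ.* ε) (½-pos 0<ε) =
  N ℕ.⊔ M , λ m n L≤m L≤n → split (eq (x m) (y m) (x′ n) (y′ n))
    (h m n (ℕ.≤-trans N≤L L≤m) (ℕ.≤-trans N≤L L≤n))
    (k m n (ℕ.≤-trans M≤L L≤m) (ℕ.≤-trans M≤L L≤n))
  where
  N≤L = ℕ.m≤m⊔n N M
  M≤L = ℕ.m≤n⊔m N M
  open ℚ.+-*-Solver
  eq : ∀ a b c d → (a ℚ.+ b) ℚ.- (c ℚ.+ d) ≡ (a ℚ.- c) ℚ.+ (b ℚ.- d)
  eq = solve 4 (λ a b c d → (a :+ b) :- (c :+ d) := (a :- c) :+ (b :- d)) refl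

-ˢ-cong : ∀ {x y} → x ∼ y → -ˢ x ∼ -ˢ y
-ˢ-cong {x} {y} p ε 0<ε with N , h ← p ε 0<ε =
  N , λ m n N≤m N≤n → subst (ℚ._≤ ε)
    (trans (∣-∣-swap (x m) (y n)) (cong ℚ.∣_∣ (eq (x m) (y n)))) (h m n N≤m N≤n)
  where
  open ℚ.+-*-Solver
  eq : ∀ a b → b ℚ.- a ≡ ℚ.- a ℚ.- (ℚ.- b)
  eq = solve 2 (λ a b → b :- a := :- a :- (:- b)) refl

private
  bounded : ∀ {x y} → x ∼ y → ∃ λ B → 0ℚ ℚ.< B × ∃ λ N → ∀ m → N ℕ.≤ m → ℚ.∣ x m ∣ ℚ.≤ B
  bounded {x} {y} p with N , h ← p 1ℚ (ℚ.positive⁻¹ 1ℚ) =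
    1ℚ ℚ.+ ℚ.∣ y N ∣ ,
    subst (ℚ._< 1ℚ ℚ.+ ℚ.∣ y N ∣) (ℚ.+-identityʳ 0ℚ)
      (ℚ.+-mono-<-≤ (ℚ.positive⁻¹ 1ℚ) (ℚ.0≤∣p∣ (y N))) ,
    N , λ m N≤m → subst (λ t → ℚ.∣ t ∣ ℚ.≤ 1ℚ ℚ.+ ℚ.∣ y N ∣) (eq (x m) (y N))
      (ℚ.≤-trans (ℚ.∣p+q∣≤∣p∣+∣q∣ (x m ℚ.- y N) (y N))
        (ℚ.+-monoˡ-≤ ℚ.∣ y N ∣ (h m N N≤m ℕ.≤-refl)))
    where
    open ℚ.+-*-Solver
    eq : ∀ a b → (a ℚ.- b) ℚ.+ b ≡ a
    eq = solve 2 (λ a b → (a :- b) :+ b := a) refl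

  ∣∣-*-≤ : ∀ {p q B δ} → 0ℚ ℚ.< B → ℚ.∣ p ∣ ℚ.≤ B → ℚ.∣ q ∣ ℚ.≤ δ → ℚ.∣ p ℚ.* q ∣ ℚ.≤ B ℚ.* δ
  ∣∣-*-≤ {p} {q} {B} {δ} 0<B p≤ q≤ = ℚ.≤-trans (ℚ.≤-reflexive (ℚ.∣p*q∣≡∣p∣*∣q∣ p q))
    (ℚ.≤-trans (ℚ.*-monoʳ-≤-nonNeg ℚ.∣ q ∣ {{ℚ.∣-∣-nonNeg q}} p≤)
               (ℚ.*-monoˡ-≤-nonNeg B {{ℚ.nonNegative (ℚ.<⇒≤ 0<B)}} q≤))

  divide : ∀ B ε → 0ℚ ℚ.< B → 0ℚ ℚ.< ε → ∃ λ δ → 0ℚ ℚ.< δ × B ℚ.* δ ≡ ε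
  divide B ε 0<B 0<ε = B⁻¹ ℚ.* ε , ℚ.positive⁻¹ (B⁻¹ ℚ.* ε) {{ℚ.pos*pos⇒pos B⁻¹ ε}} ,
    trans (sym (ℚ.*-assoc B B⁻¹ ε)) (trans (cong (ℚ._* ε) (ℚ.*-inverseʳ B)) (ℚ.*-identityˡ ε))
    where
    instance
      B-pos : ℚ.Positive B
      B-pos = ℚ.positive 0<B
      ε-pos : ℚ.Positive ε
      ε-pos = ℚ.positive 0<ε
      B-nonZero : ℚ.NonZero B
      B-nonZero = ℚ.pos⇒nonZero B
    B⁻¹ : ℚ
    B⁻¹ = ℚ.1/ B
    instance
      B⁻¹-pos : ℚ.Positive B⁻¹
      B⁻¹-pos = ℚ.1/pos⇒pos B

  *-small : ∀ {x x′ y y′} → x ∼ x′ → y ∼ y′ → ∀ ε → 0ℚ ℚ.< ε →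
            ∃ λ N → ∀ m n k → N ℕ.≤ m → N ℕ.≤ n → N ℕ.≤ k → ℚ.∣ x k ℚ.* (y m ℚ.- y′ n) ∣ ℚ.≤ ε
  *-small {x} {x′} {y} {y′} p q ε 0<ε = helper (bounded {x} {x′} p)
    where
    Goal : Set
    Goal = ∃ λ N → ∀ m n k → N ℕ.≤ m → N ℕ.≤ n → N ℕ.≤ k → ℚ.∣ x k ℚ.* (y m ℚ.- y′ n) ∣ ℚ.≤ ε
    helper₂ : ∀ B δ N M → 0ℚ ℚ.< B → B ℚ.* δ ≡ ε → (∀ m → N ℕ.≤ m → ℚ.∣ x m ∣ ℚ.≤ B) →
              (∀ m n → M ℕ.≤ m → M ℕ.≤ n → ℚ.∣ y m ℚ.- y′ n ∣ ℚ.≤ δ) → Goal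
    helper₂ B δ N M 0<B Bδ≡ε b h = N ℕ.⊔ M , λ m n k L≤m L≤n L≤k →
      ℚ.≤-trans {ℚ.∣ x k ℚ.* (y m ℚ.- y′ n) ∣} {B ℚ.* δ} {ε}
        (∣∣-*-≤ {x k} {y m ℚ.- y′ n} {B} {δ} 0<B (b k (ℕ.≤-trans (ℕ.m≤m⊔n N M) L≤k))
          (h m n (ℕ.≤-trans (ℕ.m≤n⊔m N M) L≤m) (ℕ.≤-trans (ℕ.m≤n⊔m N M) L≤n)))
        (ℚ.≤-reflexive Bδ≡ε)
    helper : (∃ λ B → 0ℚ ℚ.< B × ∃ λ N → ∀ m → N ℕ.≤ m → ℚ.∣ x m ∣ ℚ.≤ B) → Goal
    helper (B , 0<B , N , b) with divide B ε 0<B 0<ε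
    ... | δ , 0<δ , Bδ≡ε = helper₂ B δ N (proj₁ (q δ 0<δ)) 0<B Bδ≡ε b (proj₂ (q δ 0<δ))

*ˢ-cong : ∀ {x x′ y y′} → x ∼ x′ → y ∼ y′ → x *ˢ y ∼ x′ *ˢ y′
*ˢ-cong {x} {x′} {y} {y′} p q ε 0<ε = combine
  (*-small {x} {x′} {y} {y′} p q (½ ℚ.* ε) (½-pos 0<ε))
  (*-small {y′} {y} {x} {x′} (∼-sym {y} {y′} q) p (½ ℚ.* ε) (½-pos 0<ε))
  where
  open ℚ.+-*-Solver
  eq : ∀ a b c d → a ℚ.* b ℚ.- c ℚ.* d ≡ a ℚ.* (b ℚ.- d) ℚ.+ d ℚ.* (a ℚ.- c)
  eq = solve 4 (λ a b c d → a :* b :- c :* d := a :* (b :- d) :+ d :* (a :- c)) refl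
  combine :
    (∃ λ N → ∀ m n k → N ℕ.≤ m → N ℕ.≤ n → N ℕ.≤ k → ℚ.∣ x k ℚ.* (y m ℚ.- y′ n) ∣ ℚ.≤ ½ ℚ.* ε) →
    (∃ λ M → ∀ m n k → M ℕ.≤ m → M ℕ.≤ n → M ℕ.≤ k → ℚ.∣ y′ k ℚ.* (x m ℚ.- x′ n) ∣ ℚ.≤ ½ ℚ.* ε) →
    ∃ λ N → ∀ m n → N ℕ.≤ m → N ℕ.≤ n → ℚ.∣ x m ℚ.* y m ℚ.- x′ n ℚ.* y′ n ∣ ℚ.≤ ε
  combine (N , h) (M , k) = N ℕ.⊔ M , λ m n L≤m L≤n →
    split {x m ℚ.* y m ℚ.- x′ n ℚ.* y′ n} {x m ℚ.* (y m ℚ.- y′ n)} {y′ n ℚ.* (x m ℚ.- x′ n)} {ε}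
      (eq (x m) (y m) (x′ n) (y′ n))
      (h m n m (ℕ.≤-trans N≤L L≤m) (ℕ.≤-trans N≤L L≤n) (ℕ.≤-trans N≤L L≤m))
      (k m n n (ℕ.≤-trans M≤L L≤m) (ℕ.≤-trans M≤L L≤n) (ℕ.≤-trans M≤L L≤n))
    where
    N≤L = ℕ.m≤m⊔n N M
    M≤L = ℕ.m≤n⊔m N M

record ℝ : Set where
  no-eta-equality
  field
    seq    : Sequence
    cauchy : seq ∼ seq

open ℝ

infix 4 _≈ᴿ_

record _≈ᴿ_ (x y : ℝ) : Set where
  constructor close
  field
    seq-∼ : seq x ∼ seq y

open _≈ᴿ_

≈ᴿ-pointwise : ∀ x {y} → (∀ n → seq x n ≡ seq y n) → x ≈ᴿ y
≈ᴿ-pointwise x x≗y = close (∼-resp-≗ (cauchy x) x≗y)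

ℝ-commutativeRing : CommutativeRing 0ℓ 0ℓ
ℝ-commutativeRing = record
  { Carrier = ℝ
  ; _≈_ = _≈ᴿ_
  ; _+_ = add
  ; _*_ = mul
  ; -_ = neg
  ; 0# = zer
  ; 1# = one
  ; isCommutativeRing = record
    { isRing = record
      { +-isAbelianGroup = record
        { isGroup = record
          { isMonoid = record
            { isSemigroup = record
              { isMagma = record
                { isEquivalence = record
                  { refl = λ {x} → close (cauchy x)
                  ; sym = λ {x} {y} p → close (∼-sym {seq x} {seq y} (seq-∼ p))
                  ; trans = λ {x} {y} {z} p q →
                      close (∼-trans {seq x} {seq y} {seq z} (seq-∼ p) (seq-∼ q)) }
                ; ∙-cong = λ {x} {y} {u} {v} p q →
                    close (+ˢ-cong {seq x} {seq y} {seq u} {seq v} (seq-∼ p) (seq-∼ q)) }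
              ; assoc = λ x y z → ≈ᴿ-pointwise (add (add x y) z) λ n → ℚ.+-assoc (seq x n) (seq y n) (seq z n) }
            ; identity = (λ x → ≈ᴿ-pointwise (add zer x) λ n → ℚ.+-identityˡ (seq x n))
                       , (λ x → ≈ᴿ-pointwise (add x zer) λ n → ℚ.+-identityʳ (seq x n)) }
          ; inverse = (λ x → ≈ᴿ-pointwise (add (neg x) x) λ n → ℚ.+-inverseˡ (seq x n))
                    , (λ x → ≈ᴿ-pointwise (add x (neg x)) λ n → ℚ.+-inverseʳ (seq x n))
          ; ⁻¹-cong = λ {x} {y} p → close (-ˢ-cong {seq x} {seq y} (seq-∼ p)) }
        ; comm = λ x y → ≈ᴿ-pointwise (add x y) λ n → ℚ.+-comm (seq x n) (seq y n) }
      ; *-cong = λ {x} {y} {u} {v} p q →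
          close (*ˢ-cong {seq x} {seq y} {seq u} {seq v} (seq-∼ p) (seq-∼ q))
      ; *-assoc = λ x y z → ≈ᴿ-pointwise (mul (mul x y) z) λ n → ℚ.*-assoc (seq x n) (seq y n) (seq z n)
      ; *-identity = (λ x → ≈ᴿ-pointwise (mul one x) λ n → ℚ.*-identityˡ (seq x n))
                   , (λ x → ≈ᴿ-pointwise (mul x one) λ n → ℚ.*-identityʳ (seq x n))
      ; distrib = (λ x y z → ≈ᴿ-pointwise (mul x (add y z)) λ n → ℚ.*-distribˡ-+ (seq x n) (seq y n) (seq z n))
                , (λ x y z → ≈ᴿ-pointwise (mul (add y z) x) λ n → ℚ.*-distribʳ-+ (seq x n) (seq y n) (seq z n)) }
    ; *-comm = λ x y → ≈ᴿ-pointwise (mul x y) λ n → ℚ.*-comm (seq x n) (seq y n) } }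
  where
  add mul : ℝ → ℝ → ℝ
  seq    (add x y) = seq x +ˢ seq y
  cauchy (add x y) = +ˢ-cong {seq x} {seq x} {seq y} {seq y} (cauchy x) (cauchy y)
  seq    (mul x y) = seq x *ˢ seq y
  cauchy (mul x y) = *ˢ-cong {seq x} {seq x} {seq y} {seq y} (cauchy x) (cauchy y)
  neg : ℝ → ℝ
  seq    (neg x) = -ˢ seq x
  cauchy (neg x) = -ˢ-cong {seq x} {seq x} (cauchy x)
  zer one : ℝ
  seq    zer = λ _ → 0ℚ
  cauchy zer = constant-∼ 0ℚ
  seq    one = λ _ → 1ℚ
  cauchy one = constant-∼ 1ℚ

record ℂ : Set where
  constructor _+i_
  field
    re im : ℝ

open ℂ

infix 4 _≈ℂ_

record _≈ℂ_ (z w : ℂ) : Set where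
  constructor _,_
  field
    re-≈ : re z ≈ᴿ re w
    im-≈ : im z ≈ᴿ im w

ℂ-commutativeRing : CommutativeRing 0ℓ 0ℓ
ℂ-commutativeRing = record
  { Carrier = ℂ
  ; _≈_ = _≈ℂ_
  ; _+_ = λ z w → (re z + re w) +i (im z + im w)
  ; _*_ = λ z w → (re z * re w - im z * im w) +i (re z * im w + im z * re w)
  ; -_ = λ z → (- re z) +i (- im z)
  ; 0# = 0# +i 0#
  ; 1# = 1# +i 0#
  ; isCommutativeRing = record
    { isRing = record
      { +-isAbelianGroup = record
        { isGroup = record
          { isMonoid = record
            { isSemigroup = record
              { isMagma = record
                { isEquivalence = record
                  { refl = R.refl , R.refl
                  ; sym = λ (p , q) → R.sym p , R.sym q
                  ; trans = λ (p , q) (p′ , q′) → R.trans p p′ , R.trans q q′ }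
                ; ∙-cong = λ (p , q) (p′ , q′) → R.+-cong p p′ , R.+-cong q q′ }
              ; assoc = λ x y z → R.+-assoc _ _ _ , R.+-assoc _ _ _ }
            ; identity = (λ x → R.+-identityˡ _ , R.+-identityˡ _)
                       , (λ x → R.+-identityʳ _ , R.+-identityʳ _) }
          ; inverse = (λ x → R.-‿inverseˡ _ , R.-‿inverseˡ _)
                    , (λ x → R.-‿inverseʳ _ , R.-‿inverseʳ _)
          ; ⁻¹-cong = λ (p , q) → R.-‿cong p , R.-‿cong q }
        ; comm = λ x y → R.+-comm _ _ , R.+-comm _ _ }
      ; *-cong = λ (p , q) (p′ , q′) →
            R.+-cong (R.*-cong p p′) (R.-‿cong (R.*-cong q q′))
          , R.+-cong (R.*-cong p q′) (R.*-cong q p′)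
      ; *-assoc = λ (a +i b) (c +i d) (e +i f) → assoc-re a b c d e f , assoc-im a b c d e f
      ; *-identity = (λ (a +i b) → idˡ-re a b , idˡ-im a b) , (λ (a +i b) → idʳ-re a b , idʳ-im a b)
      ; distrib = (λ (a +i b) (c +i d) (e +i f) → distˡ-re a b c d e f , distˡ-im a b c d e f)
                , (λ (a +i b) (c +i d) (e +i f) → distʳ-re a b c d e f , distʳ-im a b c d e f) }
    ; *-comm = λ (a +i b) (c +i d) → comm-re a b c d , comm-im a b c d } }
  where
  module R = CommutativeRing ℝ-commutativeRing
  open R using (_≈_; _+_; _*_; -_; _-_; 0#; 1#)
  open ℚ.+-*-Solver
  assoc-re : ∀ a b c d e f → (a * c - b * d) * e - (a * d + b * c) * f ≈
    a * (c * e - d * f) - b * (c * f + d * e)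
  assoc-re a b c d e f = ≈ᴿ-pointwise ((a * c - b * d) * e - (a * d + b * c) * f) λ n → solve 6
    (λ a b c d e f → (a :* c :- b :* d) :* e :- (a :* d :+ b :* c) :* f :=
      a :* (c :* e :- d :* f) :- b :* (c :* f :+ d :* e))
    refl (seq a n) (seq b n) (seq c n) (seq d n) (seq e n) (seq f n)
  assoc-im : ∀ a b c d e f → (a * c - b * d) * f + (a * d + b * c) * e ≈
    a * (c * f + d * e) + b * (c * e - d * f)
  assoc-im a b c d e f = ≈ᴿ-pointwise ((a * c - b * d) * f + (a * d + b * c) * e) λ n → solve 6
    (λ a b c d e f → (a :* c :- b :* d) :* f :+ (a :* d :+ b :* c) :* e :=
      a :* (c :* f :+ d :* e) :+ b :* (c :* e :- d :* f))
    refl (seq a n) (seq b n) (seq c n) (seq d n) (seq e n) (seq f n)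
  distˡ-re : ∀ a b c d e f → a * (c + e) - b * (d + f) ≈
    (a * c - b * d) + (a * e - b * f)
  distˡ-re a b c d e f = ≈ᴿ-pointwise (a * (c + e) - b * (d + f)) λ n → solve 6
    (λ a b c d e f → a :* (c :+ e) :- b :* (d :+ f) :=
      (a :* c :- b :* d) :+ (a :* e :- b :* f))
    refl (seq a n) (seq b n) (seq c n) (seq d n) (seq e n) (seq f n)
  distˡ-im : ∀ a b c d e f → a * (d + f) + b * (c + e) ≈
    (a * d + b * c) + (a * f + b * e)
  distˡ-im a b c d e f = ≈ᴿ-pointwise (a * (d + f) + b * (c + e)) λ n → solve 6
    (λ a b c d e f → a :* (d :+ f) :+ b :* (c :+ e) :=
      (a :* d :+ b :* c) :+ (a :* f :+ b :* e))
    refl (seq a n) (seq b n) (seq c n) (seq d n) (seq e n) (seq f n)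
  distʳ-re : ∀ a b c d e f → (c + e) * a - (d + f) * b ≈
    (c * a - d * b) + (e * a - f * b)
  distʳ-re a b c d e f = ≈ᴿ-pointwise ((c + e) * a - (d + f) * b) λ n → solve 6
    (λ a b c d e f → (c :+ e) :* a :- (d :+ f) :* b :=
      (c :* a :- d :* b) :+ (e :* a :- f :* b))
    refl (seq a n) (seq b n) (seq c n) (seq d n) (seq e n) (seq f n)
  distʳ-im : ∀ a b c d e f → (c + e) * b + (d + f) * a ≈
    (c * b + d * a) + (e * b + f * a)
  distʳ-im a b c d e f = ≈ᴿ-pointwise ((c + e) * b + (d + f) * a) λ n → solve 6
    (λ a b c d e f → (c :+ e) :* b :+ (d :+ f) :* a :=
      (c :* b :+ d :* a) :+ (e :* b :+ f :* a))
    refl (seq a n) (seq b n) (seq c n) (seq d n) (seq e n) (seq f n)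
  comm-re : ∀ a b c d → a * c - b * d ≈ c * a - d * b
  comm-re a b c d = ≈ᴿ-pointwise (a * c - b * d) λ n → solve 4
    (λ a b c d → a :* c :- b :* d := c :* a :- d :* b) refl (seq a n) (seq b n) (seq c n) (seq d n)
  comm-im : ∀ a b c d → a * d + b * c ≈ c * b + d * a
  comm-im a b c d = ≈ᴿ-pointwise (a * d + b * c) λ n → solve 4
    (λ a b c d → a :* d :+ b :* c := c :* b :+ d :* a) refl (seq a n) (seq b n) (seq c n) (seq d n)
  idˡ-re : ∀ a b → 1# * a - 0# * b ≈ a
  idˡ-re a b = ≈ᴿ-pointwise (1# * a - 0# * b) λ n → solve 2
    (λ a b → con 1ℚ :* a :- con 0ℚ :* b := a) refl (seq a n) (seq b n)
  idˡ-im : ∀ a b → 1# * b + 0# * a ≈ b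
  idˡ-im a b = ≈ᴿ-pointwise (1# * b + 0# * a) λ n → solve 2
    (λ a b → con 1ℚ :* b :+ con 0ℚ :* a := b) refl (seq a n) (seq b n)
  idʳ-re : ∀ a b → a * 1# - b * 0# ≈ a
  idʳ-re a b = ≈ᴿ-pointwise (a * 1# - b * 0#) λ n → solve 2
    (λ a b → a :* con 1ℚ :- b :* con 0ℚ := a) refl (seq a n) (seq b n)
  idʳ-im : ∀ a b → a * 0# + b * 1# ≈ b
  idʳ-im a b = ≈ᴿ-pointwise (a * 0# + b * 1#) λ n → solve 2
    (λ a b → a :* con 0ℚ :+ b :* con 1ℚ := b) refl (seq a n) (seq b n)

module OverRing {k e : Level} (R : CommutativeRing k e) where

  open CommutativeRing R using (_≈_; _+_; _*_; -_; 0#; 1#; semiring) renaming (Carrier to K)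
  open SemiringExp semiring using (_^_)

  sumOver : ∀ {a} {A : Set a} → List A → (A → K) → K
  sumOver xs f = foldr _+_ 0# (map f xs)

  sign : ℕ → K
  sign m = (- 1#) ^ m

  record QuasiGradedPoset (c ℓ : Level) : Set (Level.suc (c ⊔ ℓ) ⊔ k ⊔ e) where
    infix 4 _≤_ _<_ _<?_
    field
      Carrier           : Set c
      _≤_               : Rel Carrier ℓ
      isDecPartialOrder : IsDecPartialOrder _≡_ _≤_
      size              : ℕ
      enumeration       : Fin size ↔ Carrier

    open IsDecPartialOrder isDecPartialOrder public using (_≤?_; _≟_)

    _<_ : Rel Carrier (c ⊔ ℓ)
    _<_ = ToStrict._<_ _≡_ _≤_

    _<?_ : Decidable _<_
    _<?_ = ToStrict.<-decidable _≡_ _≤_ _≟_ _≤?_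

    elements : List Carrier
    elements = map (Inverse.to enumeration) (allFin size)

    -- Elements of the incidence algebra are functions on the pairs x ≤ y, here extended by zero.
    field
      ρ         : Carrier → ℕ
      ρ-mono-<  : ∀ {x y} → x < y → ρ x ℕ.< ρ y
      ζ̄         : Carrier → Carrier → K
      ζ̄-support : ∀ {x y} → ¬ (x ≤ y) → ζ̄ x y ≈ 0#
      ζ̄-diag    : ∀ x → ζ̄ x x ≈ 1#

    -- Truncated subtraction is harmless: this is only used for x ≤ y, and then ρ x ≤ ρ y.
    ρ[_,_] : Carrier → Carrier → ℕ
    ρ[ x , y ] = ρ y ∸ ρ x

    δ : Carrier → Carrier → K
    δ x z with x ≟ z
    ... | yes _ = 1#
    ... | no  _ = 0#

    interval : Carrier → Carrier → List Carrier
    interval x z = filter (λ y → (x ≤? y) ×-dec (y ≤? z)) elements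

    Eulerian : Set (c ⊔ ℓ ⊔ e)
    Eulerian = ∀ x z → x ≤ z →
      sumOver (interval x z) (λ y → sign ρ[ x , y ] * ζ̄ x y * ζ̄ y z) ≈ δ x z

    lists : ℕ → List (List Carrier)
    lists zero    = [ [] ]
    lists (suc m) = cartesianProductWith _∷_ elements (lists m)

    -- ζ̄(x₀,x₁) ζ̄(x₁,x₂) ⋯ for a list x₀, x₁, x₂, …
    weight : List Carrier → K
    weight []           = 1#
    weight (x ∷ [])     = 1#
    weight (x ∷ y ∷ xs) = ζ̄ x y * weight (y ∷ xs)

  record Bounds {c ℓ} (P : QuasiGradedPoset c ℓ) : Set (c ⊔ ℓ) where
    open QuasiGradedPoset P
    field
      0̂ 1̂     : Carrier
      minimum : Minimum _≤_ 0̂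
      maximum : Maximum _≤_ 1̂
      ρ-0̂     : ρ 0̂ ≡ 0

    rank : ℕ
    rank = ρ 1̂

    augment : List Carrier → List Carrier
    augment xs = 0̂ ∷ xs ++ [ 1̂ ]

    -- The lists x₁, …, xₖ such that 0̂ < x₁ < ⋯ < xₖ < 1̂ and ρ xᵢ = sᵢ for all i.
    chains : List ℕ → List (List Carrier)
    chains s = filter (λ xs → linked? _<?_ (augment xs) ×-dec ≡-dec ℕ._≟_ (map ρ xs) s)
                      (lists (length s))

  -- S : Subset n stands for the subset {toℕ i + 1 ∣ i ∈ S} of {1, …, n};
  -- its elements are listed in increasing order.
  ranks : ∀ {n} → Subset n → List ℕ
  ranks {n} S = map (suc ∘ toℕ) (filter (_∈? S) (allFin n))

  subsets : ∀ n → List (Subset n)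
  subsets zero    = [ [] ]
  subsets (suc n) = cartesianProductWith _∷_ (outside ∷ inside ∷ []) (subsets n)

  module Flag {c ℓ} {P : QuasiGradedPoset c ℓ} (B : Bounds P) where
    open QuasiGradedPoset P
    open Bounds B

    f̄ : ∀ {n} → Subset n → K
    f̄ S = sumOver (chains (ranks S)) (weight ∘ augment)

    h̄ : ∀ {n} → Subset n → K
    h̄ {n} S = sumOver (filter (_⊆? S) (subsets n)) (λ T → sign ∣ S ─ T ∣ * f̄ T)

open OverRing ℂ-commutativeRing public

{-# OPTIONS --safe #-}
-- Write Z for the matrix of ζ̄, D_k for the projection onto the elements of rank k, and e for the
-- indicator of 1̂.  Since Z is triangular, h̄_S is the 0̂-entry of Z v_S, where
-- v_S = (D_{s₁} Z − I) ⋯ (D_{sₖ} Z − I) e.  Restrict S and its complement to the ranks ≥ k, giving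
-- vectors v and w.  Descending in k, one shows that Z v = J w and Z w = J v on ranks ≥ k,
-- where J is the diagonal matrix of the signs (−1)^(ρ − k): by the Eulerian relation the
-- inverse of Z is Z conjugated by J, and comparing v with Z⁻¹ (Z v) at rank k − 1, where v
-- vanishes, gives Z v = Z w there.  This carries the induction down to rank 0, that is, to 0̂.

module Submission where

open import Algebra.Bundles using (CommutativeRing)
import Algebra.Properties.CommutativeSemigroup as CommutativeSemigroupProperties
import Algebra.Properties.Ring as RingProperties
open import Data.Bool using (Bool; true; false; _∧_)
open import Data.Bool.Properties using (∧-zeroʳ)
open import Data.Fin using (toℕ) renaming (suc to fsuc)
open import Data.Fin.Subset using (Subset; ∁; inside; outside; _─_; ∣_∣)
open import Data.Fin.Subset.Properties using (_∈?_; _⊆?_)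
open import Data.List as List
  using (List; []; _∷_; _++_; [_]; map; filter; length; allFin; tabulate; cartesianProductWith)
open import Data.List.Membership.Propositional using (_∈_)
open import Data.List.Membership.Propositional.Properties using (∈-map⁺; ∈-allFin)
open import Data.List.Properties using (≡-dec; map-tabulate; map-cong; map-∘)
import Data.List.Relation.Unary.All as All
open import Data.List.Relation.Unary.Any using (here; there)
open import Data.List.Relation.Unary.AllPairs using ([]; _∷_)
open import Data.List.Relation.Unary.Linked using (linked?)
open import Data.List.Relation.Unary.Unique.Propositional using (Unique)
open import Data.List.Relation.Unary.Unique.Propositional.Properties using (allFin⁺; map⁺)
open import Data.Nat using (ℕ; zero; suc; _∸_; s≤s)
import Data.Nat as ℕ
import Data.Nat.Properties as ℕ
open import Data.Product using (_,_)
open import Data.Sum using (_⊎_; inj₁; inj₂)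
open import Data.Vec as Vec using ([]; _∷_)
import Defs
open import Function using (_∘_; id; Inverse; Injection)
open import Function.Properties.Inverse using (Inverse⇒Injection)
open import Level using (Level)
open import Relation.Binary.PropositionalEquality as ≡ using (_≡_; _≢_)
open import Relation.Binary.Structures using (IsDecPartialOrder)
open import Relation.Nullary using (Dec; yes; no; does; contradiction)
open import Relation.Nullary.Decidable using (_×-dec_; dec-true; dec-false)
open import Relation.Unary using (Pred) renaming (Decidable to Decidable₁)

-- Ranks of a subset, by recursion on its indicator vector.

ranksFrom : ∀ {n} → ℕ → Subset n → List ℕ
ranksFrom k []            = []
ranksFrom k (outside ∷ S) = ranksFrom (suc k) S
ranksFrom k (inside  ∷ S) = k ∷ ranksFrom (suc k) S

filter-∈?-suc : ∀ {n} s (S : Subset n) xs →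
                filter (_∈? (s ∷ S)) (map fsuc xs) ≡ map fsuc (filter (_∈? S) xs)
filter-∈?-suc s S []       = ≡.refl
filter-∈?-suc s S (x ∷ xs) with does (x ∈? S)
... | false = filter-∈?-suc s S xs
... | true  = ≡.cong (fsuc x ∷_) (filter-∈?-suc s S xs)

-- At offset 1 the left side is `ranks S` by computation. The offset is left general because the
-- tail of `S` starts one rank higher.
ranksFrom-filter : ∀ {n} k (S : Subset n) →
                   map (λ i → k ℕ.+ toℕ i) (filter (_∈? S) (allFin n)) ≡ ranksFrom k S

private
  ranksFrom-filter-suc : ∀ {n} k s (S : Subset n) →
    map (λ i → k ℕ.+ toℕ i) (filter (_∈? (s ∷ S)) (tabulate fsuc)) ≡ ranksFrom (suc k) S
  ranksFrom-filter-suc {n} k s S = begin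
    map (λ i → k ℕ.+ toℕ i) (filter (_∈? (s ∷ S)) (tabulate fsuc))
      ≡⟨ ≡.cong (map (λ i → k ℕ.+ toℕ i) ∘ filter (_∈? (s ∷ S))) (map-tabulate id fsuc) ⟨
    map (λ i → k ℕ.+ toℕ i) (filter (_∈? (s ∷ S)) (map fsuc (allFin n)))
      ≡⟨ ≡.cong (map (λ i → k ℕ.+ toℕ i)) (filter-∈?-suc s S (allFin n)) ⟩
    map (λ i → k ℕ.+ toℕ i) (map fsuc (filter (_∈? S) (allFin n)))
      ≡⟨ map-∘ (filter (_∈? S) (allFin n)) ⟨
    map (λ i → k ℕ.+ suc (toℕ i)) (filter (_∈? S) (allFin n))
      ≡⟨ map-cong (λ i → ℕ.+-suc k (toℕ i)) (filter (_∈? S) (allFin n)) ⟩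
    map (λ i → suc k ℕ.+ toℕ i) (filter (_∈? S) (allFin n))
      ≡⟨ ranksFrom-filter (suc k) S ⟩
    ranksFrom (suc k) S ∎
    where open ≡.≡-Reasoning

ranksFrom-filter k []            = ≡.refl
ranksFrom-filter k (outside ∷ S) = ranksFrom-filter-suc k outside S
ranksFrom-filter k (inside ∷ S)  =
  ≡.cong₂ _∷_ (ℕ.+-identityʳ k) (ranksFrom-filter-suc k inside S)

module SymmetryOverRing {κ ε : Level} (R : CommutativeRing κ ε) where

  open CommutativeRing R renaming (Carrier to K)
  open CommutativeSemigroupProperties *-commutativeSemigroup using (x∙yz≈y∙xz)
  open CommutativeSemigroupProperties +-commutativeSemigroup using (interchange)
  open RingProperties ring using (-‿distribˡ-*; -‿distribʳ-*; -‿+-comm; -‿involutive; -0#≈0#; -1*x≈-x)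
  open import Relation.Binary.Reasoning.Setoid setoid
  open Defs.OverRing R

  private
    variable
      a p : Level
      A A′ A″ : Set a

  -- Finite sums over lists.

  sum-cong : ∀ (xs : List A) {f g : A → K} → (∀ x → f x ≈ g x) → sumOver xs f ≈ sumOver xs g
  sum-cong []       f≈g = refl
  sum-cong (x ∷ xs) f≈g = +-cong (f≈g x) (sum-cong xs f≈g)

  sum-zero : ∀ (xs : List A) {f : A → K} → (∀ x → f x ≈ 0#) → sumOver xs f ≈ 0#
  sum-zero []       f≈0 = refl
  sum-zero (x ∷ xs) f≈0 = trans (+-cong (f≈0 x) (sum-zero xs f≈0)) (+-identityˡ 0#)

  sum-+ : ∀ (xs : List A) (f g : A → K) →
          sumOver xs (λ x → f x + g x) ≈ sumOver xs f + sumOver xs g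
  sum-+ []       f g = sym (+-identityˡ 0#)
  sum-+ (x ∷ xs) f g = trans (+-congˡ (sum-+ xs f g)) (interchange _ _ _ _)

  *-sum : ∀ (xs : List A) c (f : A → K) → c * sumOver xs f ≈ sumOver xs (λ x → c * f x)
  *-sum []       c f = zeroʳ c
  *-sum (x ∷ xs) c f = trans (distribˡ c _ _) (+-congˡ (*-sum xs c f))

  sum-neg : ∀ (xs : List A) (f : A → K) → sumOver xs (λ x → - f x) ≈ - sumOver xs f
  sum-neg []       f = sym -0#≈0#
  sum-neg (x ∷ xs) f = trans (+-congˡ (sum-neg xs f)) (-‿+-comm _ _)

  sum-swap : ∀ (xs : List A) (ys : List A′) (f : A → A′ → K) →
             sumOver xs (λ x → sumOver ys (f x)) ≈ sumOver ys (λ y → sumOver xs (λ x → f x y))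
  sum-swap []       ys f = sym (sum-zero ys λ _ → refl)
  sum-swap (x ∷ xs) ys f = trans (+-congˡ (sum-swap xs ys f)) (sym (sum-+ ys _ _))

  sum-++ : ∀ (xs ys : List A) (f : A → K) → sumOver (xs ++ ys) f ≈ sumOver xs f + sumOver ys f
  sum-++ []       ys f = sym (+-identityˡ _)
  sum-++ (x ∷ xs) ys f = trans (+-congˡ (sum-++ xs ys f)) (sym (+-assoc _ _ _))

  sum-map : ∀ (xs : List A) (g : A → A′) (f : A′ → K) → sumOver (map g xs) f ≡ sumOver xs (f ∘ g)
  sum-map []       g f = ≡.refl
  sum-map (x ∷ xs) g f = ≡.cong (f (g x) +_) (sum-map xs g f)

  sum-cartesianProductWith : ∀ (_∙_ : A → A′ → A″) xs ys (f : A″ → K) →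
    sumOver (cartesianProductWith _∙_ xs ys) f ≈ sumOver xs (λ x → sumOver ys (λ y → f (x ∙ y)))
  sum-cartesianProductWith _∙_ []       ys f = refl
  sum-cartesianProductWith _∙_ (x ∷ xs) ys f = trans (sum-++ (map (x ∙_) ys) _ f)
    (+-cong (reflexive (sum-map ys (x ∙_) f)) (sum-cartesianProductWith _∙_ xs ys f))

  -- Uniqueness makes every entry other than the found one differ from `x`, so `f x` is counted
  -- exactly once.
  sum-single : ∀ {xs : List A} {x} → Unique xs → x ∈ xs → (f : A → K) →
               (∀ y → y ≢ x → f y ≈ 0#) → sumOver xs f ≈ f x
  sum-single {x = x} (x∉ ∷ _) (here ≡.refl) f off = trans (+-congˡ (rest x∉)) (+-identityʳ _)
    where
    rest : ∀ {ys} → All.All (x ≢_) ys → sumOver ys f ≈ 0#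
    rest All.[]          = refl
    rest (x≢y All.∷ x∉′) =
      trans (+-cong (off _ (x≢y ∘ ≡.sym)) (rest x∉′)) (+-identityˡ 0#)
  sum-single (y∉ ∷ u) (there x∈xs) f off =
    trans (+-cong (off _ (All.lookup y∉ x∈xs)) (sum-single u x∈xs f off)) (+-identityˡ _)

  -- Indicators and signs.

  χ : Bool → K
  χ false = 0#
  χ true  = 1#

  sum-filter : ∀ {P : Pred A p} (P? : Decidable₁ P) xs (f : A → K) →
               sumOver (filter P? xs) f ≈ sumOver xs (λ x → χ (does (P? x)) * f x)
  sum-filter P? []       f = refl
  sum-filter P? (x ∷ xs) f with does (P? x)
  ... | false = trans (sum-filter P? xs f) (sym (trans (+-congʳ (zeroˡ _)) (+-identityˡ _)))
  ... | true  = +-cong (sym (*-identityˡ _)) (sum-filter P? xs f)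

  -- For `m < n` the subtraction is not truncated, so raising the base rank by one removes exactly
  -- one factor -1.
  sign-∸ : ∀ {m n} → m ℕ.< n → sign (n ∸ m) ≈ - sign (n ∸ suc m)
  sign-∸ m<n = trans (reflexive (≡.cong sign (ℕ.+-∸-assoc 1 m<n))) (-1*x≈-x _)

  sign-square : ∀ m → sign m * sign m ≈ 1#
  sign-square zero    = *-identityˡ 1#
  sign-square (suc m) = begin
    - 1# * sign m * (- 1# * sign m)  ≈⟨ *-cong (-1*x≈-x _) (-1*x≈-x _) ⟩
    - sign m * - sign m              ≈⟨ trans (sym (-‿distribˡ-* _ _)) (-‿cong (sym (-‿distribʳ-* _ _))) ⟩
    - - (sign m * sign m)            ≈⟨ -‿involutive _ ⟩
    sign m * sign m                  ≈⟨ sign-square m ⟩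
    1#                               ∎

  -- Alternating sums over the subsets of a set.

  alternating : ∀ {n} → Subset n → (Subset n → K) → K
  alternating {n} S F = sumOver (filter (_⊆? S) (subsets n)) (λ T → sign ∣ S ─ T ∣ * F T)

  alternating-cong : ∀ {n} (S : Subset n) {F G} → (∀ T → F T ≈ G T) →
                     alternating S F ≈ alternating S G
  alternating-cong S F≈G = sum-cong (filter (_⊆? S) (subsets _)) λ T → *-congˡ (F≈G T)

  alternating-* : ∀ {n} (S : Subset n) c F → alternating S (λ T → c * F T) ≈ c * alternating S F
  alternating-* S c F = sym (trans (*-sum (filter (_⊆? S) (subsets _)) c _)
    (sum-cong (filter (_⊆? S) (subsets _)) λ T → x∙yz≈y∙xz _ _ _))

  alternating-sum : ∀ {n} (S : Subset n) (xs : List A) (F : A → Subset n → K) →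
    alternating S (λ T → sumOver xs (λ x → F x T)) ≈ sumOver xs (λ x → alternating S (F x))
  alternating-sum S xs F = trans
    (sum-cong Ts λ T → *-sum xs (sign ∣ S ─ T ∣) (λ x → F x T))
    (sum-swap Ts xs _)
    where Ts = filter (_⊆? S) (subsets _)

  alternating-[] : (F : Subset 0 → K) → alternating [] F ≈ F []
  alternating-[] F = trans (+-identityʳ _) (*-identityˡ _)

  private
    alternating-∷ : ∀ {n} s (S : Subset n) F → alternating (s ∷ S) F ≈
      sumOver (subsets n) (λ T → χ (does (outside ∷ T ⊆? s ∷ S)) *
                                 (sign ∣ (s ∷ S) ─ (outside ∷ T) ∣ * F (outside ∷ T))) +
      sumOver (subsets n) (λ T → χ (does (inside ∷ T ⊆? s ∷ S)) *
                                 (sign ∣ (s ∷ S) ─ (inside ∷ T) ∣ * F (inside ∷ T)))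
    alternating-∷ {n} s S F = trans (sum-filter (_⊆? (s ∷ S)) (subsets (suc n)) _)
      (trans (sum-cartesianProductWith Vec._∷_ (outside ∷ inside ∷ []) (subsets n) _)
             (+-congˡ (+-identityʳ _)))

  -- A subset of `outside ∷ S` cannot contain the first position, so the indicator of the other half
  -- of the sum computes to `0#`.
  alternating-outside : ∀ {n} (S : Subset n) F →
    alternating (outside ∷ S) F ≈ alternating S (F ∘ (outside ∷_))
  alternating-outside {n} S F = begin
    alternating (outside ∷ S) F  ≈⟨ alternating-∷ outside S F ⟩
    _ + _                        ≈⟨ +-congˡ (sum-zero (subsets n) λ _ → zeroˡ _) ⟩
    _ + 0#                       ≈⟨ +-identityʳ _ ⟩
    _                            ≈⟨ sum-filter (_⊆? S) (subsets n) _ ⟨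
    alternating S (F ∘ (outside ∷_)) ∎

  -- Omitting the first position from `T` enlarges `S ─ T` by one and so costs a sign; taking it
  -- leaves the difference unchanged.
  alternating-inside : ∀ {n} (S : Subset n) F →
    alternating (inside ∷ S) F ≈ alternating S (F ∘ (inside ∷_)) - alternating S (F ∘ (outside ∷_))
  alternating-inside {n} S F = begin
    alternating (inside ∷ S) F
      ≈⟨ alternating-∷ inside S F ⟩
    sumOver (subsets n) (λ T → χ (does (T ⊆? S)) * (sign (suc ∣ S ─ T ∣) * F (outside ∷ T))) + _
      ≈⟨ +-congʳ (sum-cong (subsets n) λ T →
           trans (*-congˡ (trans (*-congʳ (-1*x≈-x _)) (sym (-‿distribˡ-* _ _)))) (sym (-‿distribʳ-* _ _))) ⟩
    sumOver (subsets n) (λ T → - (χ (does (T ⊆? S)) * (sign ∣ S ─ T ∣ * F (outside ∷ T)))) + _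
      ≈⟨ +-cong (sum-neg (subsets n) _) (sym (sum-filter (_⊆? S) (subsets n) _)) ⟩
    - sumOver (subsets n) (λ T → χ (does (T ⊆? S)) * (sign ∣ S ─ T ∣ * F (outside ∷ T))) + _
      ≈⟨ +-congʳ (-‿cong (sym (sum-filter (_⊆? S) (subsets n) _))) ⟩
    - alternating S (F ∘ (outside ∷_)) + alternating S (F ∘ (inside ∷_))
      ≈⟨ +-comm _ _ ⟩
    alternating S (F ∘ (inside ∷_)) - alternating S (F ∘ (outside ∷_)) ∎

  -- The matrix of `ζ̄` acting on vectors.

  module _ {c ℓ} (P : QuasiGradedPoset c ℓ) where
    open QuasiGradedPoset P
    private
      module ≤ = IsDecPartialOrder isDecPartialOrder

    elements-unique : Unique elements
    elements-unique = map⁺ (Injection.injective (Inverse⇒Injection enumeration)) (allFin⁺ size)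

    ∈-elements : ∀ x → x ∈ elements
    ∈-elements x = ≡.subst (_∈ elements) (Inverse.strictlyInverseˡ enumeration x)
      (∈-map⁺ (Inverse.to enumeration) (∈-allFin _))

    sum-elements-single : ∀ x (f : Carrier → K) → (∀ y → y ≢ x → f y ≈ 0#) → sumOver elements f ≈ f x
    sum-elements-single x = sum-single elements-unique (∈-elements x)

    Z : (Carrier → K) → Carrier → K
    Z v x = sumOver elements (λ y → ζ̄ x y * v y)

    Z-+ : ∀ v w x → Z (λ y → v y + w y) x ≈ Z v x + Z w x
    Z-+ v w x = trans (sum-cong elements λ y → distribˡ _ _ _) (sum-+ elements _ _)

    Z-neg : ∀ v x → Z (λ y → - v y) x ≈ - Z v x
    Z-neg v x = trans (sum-cong elements λ y → sym (-‿distribʳ-* _ _)) (sum-neg elements _)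

    -- Triangularity: row `x` is supported on the elements above `x`, so if `v` vanishes strictly
    -- above `x`, only the diagonal entry 1 contributes.
    Z-diagonal : ∀ v x → (∀ y → x < y → v y ≈ 0#) → Z v x ≈ v x
    Z-diagonal v x v≈0 = trans (sum-elements-single x _ off) (trans (*-congʳ (ζ̄-diag x)) (*-identityˡ _))
      where
      off : ∀ y → y ≢ x → ζ̄ x y * v y ≈ 0#
      off y y≢x with x ≤? y
      ... | yes x≤y = trans (*-congˡ (v≈0 y (x≤y , y≢x ∘ ≡.sym))) (zeroʳ _)
      ... | no  x≰y = trans (*-congʳ (ζ̄-support x≰y)) (zeroˡ _)

    D : ℕ → (Carrier → K) → Carrier → K
    D k v x = χ (does (ρ x ℕ.≟ k)) * v x

    D-on : ∀ {k x} v → ρ x ≡ k → D k v x ≈ v x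
    D-on {k} {x} v ρx≡k = trans (*-congʳ (reflexive (≡.cong χ (dec-true (ρ x ℕ.≟ k) ρx≡k)))) (*-identityˡ _)

    D-off : ∀ {k x} v → ρ x ≢ k → D k v x ≈ 0#
    D-off {k} {x} v ρx≢k = trans (*-congʳ (reflexive (≡.cong χ (dec-false (ρ x ℕ.≟ k) ρx≢k)))) (zeroˡ _)

    D-step : ℕ → (Carrier → K) → Carrier → K
    D-step k v x = D k (Z v) x - v x

    -- Everything strictly above an element of rank at least `k` has rank greater than `k`, where
    -- `D k (Z v)` vanishes; hence `Z-diagonal` applies to that summand.
    Z-D-step : ∀ {k x} v → k ℕ.≤ ρ x → Z (D-step k v) x ≈ D k (Z v) x - Z v x
    Z-D-step {k} {x} v k≤ρx = begin
      Z (D-step k v) x                ≈⟨ Z-+ _ _ x ⟩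
      Z (D k (Z v)) x + Z (-_ ∘ v) x  ≈⟨ +-cong (Z-diagonal _ x λ y x<y →
                                           D-off (Z v) (ℕ.>⇒≢ (ℕ.≤-<-trans k≤ρx (ρ-mono-< x<y)))) (Z-neg v x) ⟩
      D k (Z v) x - Z v x             ∎

    -- Inversion of the matrix by the Eulerian relation.

    module _ (eulerian : Eulerian) where

      -- The inverse matrix: `ζ̄` conjugated by the diagonal of signs. The subtraction in the
      -- exponent can only truncate where `ζ̄` vanishes.
      signedZ : Carrier → Carrier → K
      signedZ x y = sign ρ[ x , y ] * ζ̄ x y

      -- For `x ≤ z` the support of `ζ̄` kills all terms outside the interval, so the Eulerian sum
      -- may run over all elements. Otherwise no `y` lies between `x` and `z`, and both sides are
      -- zero.
      signedZ-ζ̄ : ∀ x z → sumOver elements (λ y → signedZ x y * ζ̄ y z) ≈ δ x z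
      signedZ-ζ̄ x z with x ≤? z
      ... | yes x≤z = trans (sym (trans (sum-filter _ elements _) (sum-cong elements inInterval))) (eulerian x z x≤z)
        where
        inInterval : ∀ y → χ (does ((x ≤? y) ×-dec (y ≤? z))) * (signedZ x y * ζ̄ y z) ≈ signedZ x y * ζ̄ y z
        inInterval y with x ≤? y | y ≤? z
        ... | yes _   | yes _   = *-identityˡ _
        ... | yes _   | no  y≰z = trans (zeroˡ _) (sym (trans (*-congˡ (ζ̄-support y≰z)) (zeroʳ _)))
        ... | no  x≰y | _       = trans (zeroˡ _)
          (sym (trans (*-congʳ (trans (*-congˡ (ζ̄-support x≰y)) (zeroʳ _))) (zeroˡ _)))
      ... | no  x≰z = trans (sum-zero elements zero-term) (sym δ≈0)
        where
        δ≈0 : δ x z ≈ 0#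
        δ≈0 with x ≟ z
        ... | yes ≡.refl = contradiction ≤.refl x≰z
        ... | no  _      = refl
        zero-term : ∀ y → signedZ x y * ζ̄ y z ≈ 0#
        zero-term y with x ≤? y
        ... | yes x≤y = trans (*-congˡ (ζ̄-support λ y≤z → x≰z (≤.trans x≤y y≤z))) (zeroʳ _)
        ... | no  x≰y = trans (*-congʳ (trans (*-congˡ (ζ̄-support x≰y)) (zeroʳ _))) (zeroˡ _)

      signedZ-Z : ∀ v x → sumOver elements (λ y → signedZ x y * Z v y) ≈ v x
      signedZ-Z v x = begin
        sumOver elements (λ y → signedZ x y * Z v y)
          ≈⟨ sum-cong elements (λ y → trans (*-sum elements _ _) (sum-cong elements λ z → sym (*-assoc _ _ _))) ⟩
        sumOver elements (λ y → sumOver elements (λ z → signedZ x y * ζ̄ y z * v z))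
          ≈⟨ sum-swap elements elements _ ⟩
        sumOver elements (λ z → sumOver elements (λ y → signedZ x y * ζ̄ y z * v z))
          ≈⟨ sum-cong elements (λ z → trans (sum-cong elements λ y → *-comm _ _)
               (trans (sym (*-sum elements (v z) _)) (*-congˡ (signedZ-ζ̄ x z)))) ⟩
        sumOver elements (λ z → v z * δ x z)
          ≈⟨ sum-elements-single x _ (λ y y≢x → trans (*-congˡ (δ-≢ y (y≢x ∘ ≡.sym))) (zeroʳ _)) ⟩
        v x * δ x x
          ≈⟨ trans (*-congˡ δ-refl) (*-identityʳ _) ⟩
        v x ∎
        where
        δ-≢ : ∀ y → x ≢ y → δ x y ≈ 0#
        δ-≢ y x≢y with x ≟ y
        ... | yes x≡y = contradiction x≡y x≢y
        ... | no  _   = refl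
        δ-refl : δ x x ≈ 1#
        δ-refl with x ≟ x
        ... | yes _   = refl
        ... | no  x≢x = contradiction ≡.refl x≢x

      -- Complementary vectors and the descent in rank.

      -- The invariant of the descending induction. Signs are counted from the threshold `k`: they
      -- are trivial at the top rank, where the induction starts, and all flip when `k` drops by
      -- one.
      record Complementary (k : ℕ) (v w : Carrier → K) : Set (c Level.⊔ ε) where
        field
          v-low : ∀ x → ρ x ℕ.< k → v x ≈ 0#
          w-low : ∀ x → ρ x ℕ.< k → w x ≈ 0#
          Zv    : ∀ x → k ℕ.≤ ρ x → Z v x ≈ sign (ρ x ∸ k) * w x
          Zw    : ∀ x → k ℕ.≤ ρ x → Z w x ≈ sign (ρ x ∸ k) * v x

      swap : ∀ {k v w} → Complementary k v w → Complementary k w v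
      swap h = record { v-low = w-low ; w-low = v-low ; Zv = Zw ; Zw = Zv }
        where open Complementary h

      -- Evaluate `Z u x` twice. Since `u` vanishes strictly above `x`, triangularity gives `u x`,
      -- which is `Z v x` because `w` vanishes at `x`. By linearity and the inverse matrix it is
      -- also `v x + Z w x`, and `v` vanishes at `x` too.
      agree : ∀ {k v w} → Complementary (suc k) v w → ∀ x → ρ x ≡ k → Z v x ≈ Z w x
      agree {v = v} {w} h x ≡.refl = begin
        Z v x                                                       ≈⟨ +-identityʳ _ ⟨
        Z v x + 0#                                                  ≈⟨ +-cong u-diag (w-low x ℕ.≤-refl) ⟨
        sign ρ[ x , x ] * Z v x + w x                               ≈⟨ Z-diagonal u x u≈0 ⟨
        Z u x                                                       ≈⟨ Z-+ _ w x ⟩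
        Z (λ y → sign ρ[ x , y ] * Z v y) x + Z w x                 ≈⟨ +-congʳ (sum-cong elements λ y →
                                                                         trans (x∙yz≈y∙xz _ _ _) (sym (*-assoc _ _ _))) ⟩
        sumOver elements (λ y → signedZ x y * Z v y) + Z w x        ≈⟨ +-congʳ (signedZ-Z v x) ⟩
        v x + Z w x                                                 ≈⟨ +-congʳ (v-low x ℕ.≤-refl) ⟩
        0# + Z w x                                                  ≈⟨ +-identityˡ _ ⟩
        Z w x                                                       ∎
        where
        open Complementary h
        u : Carrier → K
        u y = sign ρ[ x , y ] * Z v y + w y
        u-diag : sign ρ[ x , x ] * Z v x ≈ Z v x
        u-diag = trans (*-congʳ (reflexive (≡.cong sign (ℕ.n∸n≡0 (ρ x))))) (*-identityˡ _)
        u≈0 : ∀ y → x < y → u y ≈ 0#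
        u≈0 y x<y = begin
          sign ρ[ x , y ] * Z v y + w y
            -- The threshold is `suc (ρ x)`, one above the base of `ρ[ x , y ]`. The two signs are
            -- therefore opposite, and their product is -1.
            ≈⟨ +-congʳ (*-cong (sign-∸ ρx<ρy) (Zv y ρx<ρy)) ⟩
          - σ * (σ * w y) + w y
            ≈⟨ +-congʳ (trans (sym (-‿distribˡ-* _ _)) (-‿cong (trans (sym (*-assoc _ _ _))
                 (trans (*-congʳ (sign-square (ρ y ∸ suc (ρ x)))) (*-identityˡ _))))) ⟩
          - w y + w y
            ≈⟨ -‿inverseˡ _ ⟩
          0# ∎
          where
          ρx<ρy = ρ-mono-< x<y
          σ = sign (ρ y ∸ suc (ρ x))

      -- Above rank `k` the new vector is `- v`, and this minus sign absorbs the flip of all signs.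
      -- At rank `k` the new vector is `Z v`, while its own image under `Z` vanishes there, as `w`
      -- does.
      step : ∀ {k v w} → Complementary (suc k) v w → Complementary k (D-step k v) w
      step {k} {v} {w} h = record
        { v-low = λ x ρx<k → trans (+-cong (D-off (Z v) (ℕ.<⇒≢ ρx<k)) (-‿cong (v-low x (ℕ.m<n⇒m<1+n ρx<k))))
                                    (-‿inverseʳ 0#)
        ; w-low = λ x ρx<k → w-low x (ℕ.m<n⇒m<1+n ρx<k)
        ; Zv    = λ x k≤ρx → trans (Z-D-step v k≤ρx) (left x (ℕ.m≤n⇒m<n∨m≡n k≤ρx))
        ; Zw    = λ x k≤ρx → right x (ℕ.m≤n⇒m<n∨m≡n k≤ρx)
        }
        where
        open Complementary h
        left : ∀ x → k ℕ.< ρ x ⊎ k ≡ ρ x → D k (Z v) x - Z v x ≈ sign (ρ x ∸ k) * w x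
        left x (inj₁ k<ρx) = begin
          D k (Z v) x - Z v x            ≈⟨ +-cong (D-off (Z v) (ℕ.>⇒≢ k<ρx)) (-‿cong (Zv x k<ρx)) ⟩
          0# - sign (ρ x ∸ suc k) * w x  ≈⟨ trans (+-identityˡ _) (-‿distribˡ-* _ _) ⟩
          - sign (ρ x ∸ suc k) * w x     ≈⟨ *-congʳ (sign-∸ k<ρx) ⟨
          sign (ρ x ∸ k) * w x           ∎
        left x (inj₂ ≡.refl) = begin
          D k (Z v) x - Z v x   ≈⟨ +-congʳ (D-on (Z v) ≡.refl) ⟩
          Z v x - Z v x         ≈⟨ -‿inverseʳ _ ⟩
          0#                    ≈⟨ trans (*-congˡ (w-low x ℕ.≤-refl)) (zeroʳ _) ⟨
          sign (ρ x ∸ k) * w x  ∎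
        right : ∀ x → k ℕ.< ρ x ⊎ k ≡ ρ x → Z w x ≈ sign (ρ x ∸ k) * D-step k v x
        right x (inj₁ k<ρx) = begin
          Z w x                             ≈⟨ Zw x k<ρx ⟩
          sign (ρ x ∸ suc k) * v x          ≈⟨ trans (sym (-‿involutive _)) (-‿cong (-‿distribʳ-* _ _)) ⟩
          - (sign (ρ x ∸ suc k) * - v x)    ≈⟨ -‿distribˡ-* _ _ ⟩
          - sign (ρ x ∸ suc k) * - v x      ≈⟨ *-cong (sign-∸ k<ρx)
                                                 (trans (+-congʳ (D-off (Z v) (ℕ.>⇒≢ k<ρx))) (+-identityˡ _)) ⟨
          sign (ρ x ∸ k) * D-step k v x     ∎
        right x (inj₂ ≡.refl) = begin
          -- This is the only case of `step` that rests on the Eulerian relation.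
          Z w x                          ≈⟨ agree h x ≡.refl ⟨
          Z v x                          ≈⟨ trans (+-congˡ -0#≈0#) (+-identityʳ _) ⟨
          Z v x - 0#                     ≈⟨ +-cong (D-on (Z v) ≡.refl) (-‿cong (v-low x ℕ.≤-refl)) ⟨
          D-step k v x                   ≈⟨ *-identityˡ _ ⟨
          sign 0 * D-step k v x          ≈⟨ *-congʳ (reflexive (≡.cong sign (ℕ.n∸n≡0 k))) ⟨
          sign (ρ x ∸ k) * D-step k v x  ∎

    -- Vectors computing the flag h-vector.

    module _ (B : Bounds P) where
      open Bounds B
      open Flag B

      top : Carrier → K
      top x = χ (does (x ≟ 1̂))

      top-≢ : ∀ {x} → x ≢ 1̂ → top x ≈ 0#
      top-≢ {x} x≢1̂ = reflexive (≡.cong χ (dec-false (x ≟ 1̂) x≢1̂))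

      Z-top : ∀ x → Z top x ≈ ζ̄ x 1̂
      Z-top x = trans
        (sum-elements-single 1̂ _ λ y y≢1̂ → trans (*-congˡ (top-≢ y≢1̂)) (zeroʳ _))
        (trans (*-congˡ (reflexive (≡.cong χ (dec-true (1̂ ≟ 1̂) ≡.refl)))) (*-identityʳ _))

      -- The head of the subset stands for rank `k`. Its factor is the outermost one, so the vector
      -- is built from the highest rank downwards.
      hVector : ∀ {m} → ℕ → Subset m → Carrier → K
      hVector k []            = top
      hVector k (outside ∷ S) = hVector (suc k) S
      hVector k (inside ∷ S)  = D-step k (hVector (suc k) S)

      -- The equation `k + m ≡ rank` says that `S` covers the ranks from `k` to just below `1̂`.
      -- Each of these ranks lies in exactly one of `S` and `∁ S`, so exactly one of the two vectors
      -- takes a factor there.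
      hVector-complementary : (eulerian : Eulerian) → ∀ {m} k (S : Subset m) → k ℕ.+ m ≡ rank →
                              Complementary eulerian k (hVector k S) (hVector k (∁ S))
      hVector-complementary eulerian k []            k+0≡rank =
        record { v-low = low ; w-low = low ; Zv = high ; Zw = high }
        where
        k≡rank : k ≡ rank
        k≡rank = ≡.trans (≡.sym (ℕ.+-identityʳ k)) k+0≡rank
        low : ∀ x → ρ x ℕ.< k → top x ≈ 0#
        low x ρx<k = top-≢ λ x≡1̂ → ℕ.<⇒≢ ρx<k (≡.trans (≡.cong ρ x≡1̂) (≡.sym k≡rank))
        ρ≤k : ∀ x → ρ x ℕ.≤ k
        ρ≤k x with x ≟ 1̂
        ... | yes ≡.refl = ℕ.≤-reflexive (≡.sym k≡rank)
        ... | no  x≢1̂    = ℕ.<⇒≤ (≡.subst (ρ x ℕ.<_) (≡.sym k≡rank) (ρ-mono-< (maximum x , x≢1̂)))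
        -- No rank exceeds `k` here, so nothing lies strictly above `x` and the exponent of the sign
        -- is 0.
        high : ∀ x → k ℕ.≤ ρ x → Z top x ≈ sign (ρ x ∸ k) * top x
        high x k≤ρx = begin
          Z top x                 ≈⟨ Z-diagonal top x (λ y x<y → contradiction
                                       (ℕ.<-≤-trans (ρ-mono-< x<y) (ℕ.≤-trans (ρ≤k y) k≤ρx))
                                       (ℕ.<-irrefl ≡.refl)) ⟩
          top x                   ≈⟨ *-identityˡ _ ⟨
          sign 0 * top x          ≈⟨ *-congʳ (reflexive (≡.cong sign (ℕ.m≤n⇒m∸n≡0
                                       (ρ≤k x)))) ⟨
          sign (ρ x ∸ k) * top x  ∎
      hVector-complementary eulerian k (outside ∷ S) k+m≡rank =
        -- Rank `k` belongs to the complement, so it is the second vector that takes the factor.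
        swap eulerian (step eulerian (swap eulerian
          (hVector-complementary eulerian (suc k) S (≡.trans (≡.sym (ℕ.+-suc k _)) k+m≡rank))))
      hVector-complementary eulerian k (inside ∷ S)  k+m≡rank =
        step eulerian (hVector-complementary eulerian (suc k) S (≡.trans (≡.sym (ℕ.+-suc k _)) k+m≡rank))

      -- Vectors computing the flag f-vector, and their alternating sums.

      fVector : ∀ {m} → ℕ → Subset m → Carrier → K
      fVector k []            = top
      fVector k (outside ∷ T) = fVector (suc k) T
      fVector k (inside ∷ T)  = D k (Z (fVector (suc k) T))

      -- This expands a product of factors `D k Z - I`: a rank of `S` that lies in `T` selects
      -- `D k Z`, and one that does not selects `- I`.
      alternating-fVector : ∀ {m} k (S : Subset m) x →
                            alternating S (λ T → Z (fVector k T) x) ≈ Z (hVector k S) x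
      alternating-fVector k []            x = alternating-[] λ _ → Z top x
      alternating-fVector k (outside ∷ S) x = trans (alternating-outside S _) (alternating-fVector (suc k) S x)
      alternating-fVector k (inside ∷ S)  x = begin
        alternating (inside ∷ S) (λ T → Z (fVector k T) x)
          ≈⟨ alternating-inside S _ ⟩
        alternating S (λ T → Z (D k (Z (fVector (suc k) T))) x) - alternating S (λ T → Z (fVector (suc k) T) x)
          -- The alternating sum is linear, so it passes through the outer `Z` and then through the
          -- scalar of `D k`, where the induction hypothesis applies.
          ≈⟨ +-cong (trans (alternating-sum S elements _) (sum-cong elements λ y →
               trans (alternating-* S _ _) (*-congˡ (trans (alternating-* S _ _)
                 (*-congˡ (alternating-fVector (suc k) S y))))))
               (-‿cong (alternating-fVector (suc k) S x)) ⟩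
        Z (D k (Z (hVector (suc k) S))) x - Z (hVector (suc k) S) x
          ≈⟨ +-congˡ (Z-neg _ x) ⟨
        Z (D k (Z (hVector (suc k) S))) x + Z (-_ ∘ hVector (suc k) S) x
          ≈⟨ Z-+ _ _ x ⟨
        Z (hVector k (inside ∷ S)) x ∎

      -- Chain sums by recursion on the first element.

      chainsFrom : Carrier → List ℕ → List (List Carrier)
      chainsFrom x s = filter (λ xs → linked? _<?_ (x ∷ xs ++ [ 1̂ ]) ×-dec ≡-dec ℕ._≟_ (map ρ xs) s)
                              (lists (length s))

      -- At `0̂` and `ranks S` this is `f̄ S` by computation. With a variable bottom element,
      -- removing the first entry of a chain leaves a sum of the same kind.
      chainSum : Carrier → List ℕ → K
      chainSum x s = sumOver (chainsFrom x s) (λ xs → weight (x ∷ xs ++ [ 1̂ ]))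

      chainSum-[] : ∀ {x} → x < 1̂ → chainSum x [] ≈ ζ̄ x 1̂
      chainSum-[] {x} x<1̂ = begin
        chainSum x []
          ≈⟨ sum-filter (λ xs → linked? _<?_ (x ∷ xs ++ [ 1̂ ]) ×-dec ≡-dec ℕ._≟_ (map ρ xs) [])
                        (lists 0) (λ xs → weight (x ∷ xs ++ [ 1̂ ])) ⟩
        χ ((does (x <? 1̂) ∧ true) ∧ true) * (ζ̄ x 1̂ * 1#) + 0#
          ≈⟨ trans (+-identityʳ _) (*-cong (reflexive (≡.cong (λ b → χ ((b ∧ true) ∧ true)) (dec-true (x <? 1̂) x<1̂)))
                                            (*-identityʳ _)) ⟩
        1# * ζ̄ x 1̂
          ≈⟨ *-identityˡ _ ⟩
        ζ̄ x 1̂ ∎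

      -- In its use `a` and `c` concern only the first entry of a chain, `b` and `d` only the rest.
      -- Separating them lets the former leave the sum over the rest.
      χ-regroup : ∀ a b c d z w → χ ((a ∧ b) ∧ (c ∧ d)) * (z * w) ≈ χ a * (χ c * (z * (χ (b ∧ d) * w)))
      χ-regroup false b c     d z w = trans (zeroˡ _) (sym (zeroˡ _))
      χ-regroup true  b false d z w = trans (*-congʳ (reflexive (≡.cong χ (∧-zeroʳ b))))
        (trans (zeroˡ _) (sym (trans (*-congˡ (zeroˡ _)) (zeroʳ _))))
      χ-regroup true  b true  d z w = sym (trans (*-identityˡ _) (trans (*-identityˡ _) (x∙yz≈y∙xz _ _ _)))

      chainSum-∷ : ∀ x k s → chainSum x (k ∷ s) ≈
        sumOver elements (λ y → χ (does (x <? y)) * (χ (does (ρ y ℕ.≟ k)) * (ζ̄ x y * chainSum y s)))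
      chainSum-∷ x k s = begin
        chainSum x (k ∷ s)
          ≈⟨ sum-filter _ (lists (length (k ∷ s))) _ ⟩
        _ ≈⟨ sum-cartesianProductWith List._∷_ elements (lists (length s)) _ ⟩
        _ ≈⟨ sum-cong elements (λ y → trans
               (sum-cong (lists (length s)) λ xs →
                 χ-regroup (does (x <? y)) (does (linked? _<?_ (y ∷ xs ++ [ 1̂ ]))) (does (ρ y ℕ.≟ k))
                           (does (≡-dec ℕ._≟_ (map ρ xs) s)) (ζ̄ x y) (weight (y ∷ xs ++ [ 1̂ ])))
               -- Read backwards, the three factors that depend only on `y` are pushed one after
               -- another into the sum over tails.
               (sym (trans (*-congˡ (trans (*-congˡ (trans (*-congˡ (sum-filter _ (lists (length s)) _))
                 (*-sum (lists (length s)) _ _))) (*-sum (lists (length s)) _ _))) (*-sum (lists (length s)) _ _)))) ⟩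
        sumOver elements (λ y → χ (does (x <? y)) * (χ (does (ρ y ℕ.≟ k)) * (ζ̄ x y * chainSum y s))) ∎

      -- A chain sum requires x < y, the matrix sum does not: ζ̄ vanishes unless x ≤ y, and x ≢ y
      -- as the rank goes up.
      chainSum-ranksFrom : ∀ {m} k (T : Subset m) x → k ℕ.+ m ≡ rank → ρ x ℕ.< k →
                           chainSum x (ranksFrom k T) ≈ Z (fVector k T) x
      chainSum-ranksFrom k []            x k+0≡rank ρx<k =
        trans (chainSum-[] (maximum x , λ x≡1̂ → ℕ.<⇒≢ ρx<k
                (≡.trans (≡.cong ρ x≡1̂) (≡.sym (≡.trans (≡.sym (ℕ.+-identityʳ k)) k+0≡rank)))))
              (sym (Z-top x))
      chainSum-ranksFrom k (outside ∷ T) x k+m≡rank ρx<k =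
        chainSum-ranksFrom (suc k) T x (≡.trans (≡.sym (ℕ.+-suc k _)) k+m≡rank) (ℕ.m<n⇒m<1+n ρx<k)
      chainSum-ranksFrom k (inside ∷ T)  x k+m≡rank ρx<k =
        trans (chainSum-∷ x k (ranksFrom (suc k) T)) (sum-cong elements λ y → term y (ρ y ℕ.≟ k))
        where
        G : Carrier → K
        G y = Z (fVector (suc k) T) y
        term : ∀ y → Dec (ρ y ≡ k) →
               χ (does (x <? y)) * (χ (does (ρ y ℕ.≟ k)) * (ζ̄ x y * chainSum y (ranksFrom (suc k) T))) ≈ ζ̄ x y * D k G y
        term y (no ρy≢k) = trans (*-congˡ (D-off (λ y → ζ̄ x y * chainSum y (ranksFrom (suc k) T)) ρy≢k))
          (trans (zeroʳ _) (sym (trans (*-congˡ (D-off G ρy≢k)) (zeroʳ _))))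
        term y (yes ρy≡k) = trans (*-congˡ (trans (D-on (λ y → ζ̄ x y * chainSum y (ranksFrom (suc k) T)) ρy≡k)
            (*-congˡ (trans (chainSum-ranksFrom (suc k) T y (≡.trans (≡.sym (ℕ.+-suc k _)) k+m≡rank)
                               (s≤s (ℕ.≤-reflexive ρy≡k)))
                            (sym (D-on G ρy≡k))))))
            (χ-< (x <? y))
          where
          χ-< : ∀ (x<?y : Dec (x < y)) → χ (does x<?y) * (ζ̄ x y * D k G y) ≈ ζ̄ x y * D k G y
          χ-< (yes _)  = *-identityˡ _
          χ-< (no x≮y) = trans (zeroˡ _) (sym (trans (*-congʳ (ζ̄-support λ x≤y →
            x≮y (x≤y , λ x≡y → ℕ.<⇒≢ ρx<k (≡.trans (≡.cong ρ x≡y) ρy≡k)))) (zeroˡ _)))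

      -- Symmetry of the flag h-vector.

      h̄-hVector : ∀ {n} → rank ≡ suc n → (S : Subset n) → h̄ S ≈ Z (hVector 1 S) 0̂
      h̄-hVector rank≡1+n S = trans (alternating-cong S f̄-fVector) (alternating-fVector 1 S 0̂)
        where
        f̄-fVector : ∀ T → f̄ T ≈ Z (fVector 1 T) 0̂
        f̄-fVector T = trans (reflexive (≡.cong (chainSum 0̂) (ranksFrom-filter 1 T)))
          (chainSum-ranksFrom 1 T 0̂ (≡.sym rank≡1+n) (s≤s (ℕ.≤-reflexive ρ-0̂)))

      h̄-∁ : Eulerian → ∀ {n} → rank ≡ suc n → (S : Subset n) → h̄ S ≈ h̄ (∁ S)
      h̄-∁ eulerian rank≡1+n S = begin
        h̄ S                   ≈⟨ h̄-hVector rank≡1+n S ⟩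
        -- The vectors are complementary from rank 1 on, so `agree` applies at rank 0, that is, at
        -- `0̂`.
        Z (hVector 1 S) 0̂      ≈⟨ agree eulerian (hVector-complementary eulerian 1 S (≡.sym rank≡1+n)) 0̂ ρ-0̂ ⟩
        Z (hVector 1 (∁ S)) 0̂  ≈⟨ h̄-hVector rank≡1+n (∁ S) ⟨
        h̄ (∁ S)               ∎

open import Defs

corollary3p8 : ∀ {c ℓ : Level} (n : ℕ) (P : QuasiGradedPoset c ℓ) (B : Bounds P) →
    QuasiGradedPoset.Eulerian P →
    Bounds.rank B ≡ suc n →
    (S : Subset n) → Flag.h̄ B S ≈ℂ Flag.h̄ B (∁ S)
corollary3p8 n P B eulerian rank≡1+n = SymmetryOverRing.h̄-∁ ℂ-commutativeRing P B eulerian rank≡1+n
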